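{- For all integers $n\geq 0$ we have $$H_n\big((2k+1)E_{2k}\big)=2^{2n(n+1)}\prod_{\ell=1}^n\ell!^4.$$
   Context: The Euler numbers $E_k$ are defined by $\frac{2}{e^t+e^{ -t}}=\sum_{k\ge 0}E_k\frac{t^k}{k!}$. For a sequence $(c_0,c_1,\ldots)$ (indexed from $k=0$), $H_n(c_k)=\det\big(c_{i+j}\big)_{0\le i,j\le n}$; here $c_k=(2k+1)E_{2k}$. $\ell!^4=(\ell!)^4$, and empty products equal $1$. -}

module Defs where

open import Algebra.Bundles using (CommutativeRing)
open import Data.Fin.Base using (Fin; zero; suc; toℕ; punchIn)
open import Data.Integer.Base using (+_)
import Data.Integer.Properties as ℤ
open import Data.Nat.Base as ℕ using (ℕ; zero; suc; _∸_; _!)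
open import Data.Nat.Properties using (_!≢0)
  renaming (+-identityʳ to ℕ-+-identityʳ)
open import Data.Rational.Base using (ℚ; 0ℚ; 1ℚ; _+_; _*_; -_; _/_; 1/_; NonZero)
open import Data.Rational.Properties
open import Data.Rational.Unnormalised.Base using (mkℚᵘ; *≡*)
import Data.Rational.Unnormalised.Properties as ℚᵘ
open import Data.Vec.Base using (Vec; []; _∷_; lookup)
open import Relation.Binary.PropositionalEquality
open ≡-Reasoning
open import Algebra.Properties.Semiring.Sum (CommutativeRing.semiring +-*-commutativeRing)
  using (sum; sum-cong-≗; *-distribˡ-sum) public
open import Algebra.Properties.Semiring.Exp (CommutativeRing.semiring +-*-commutativeRing)
  using () renaming (_^_ to _^ℚ_) public

fromℕ : ℕ → ℚ
fromℕ n = + n / 1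

-- Formal power series over ℚ: f stands for Σₙ f(n) tⁿ.

Series : Set
Series = ℕ → ℚ

const : ℚ → Series
const a zero    = a
const a (suc _) = 0ℚ

infixl 6 _⊕_
infixl 7 _⊛_ _⊘_

_⊕_ : Series → Series → Series
(f ⊕ g) n = f n + g n

_⊛_ : Series → Series → Series
(f ⊛ g) n = sum λ (i : Fin (suc n)) → f (toℕ i) * g (n ∸ toℕ i)

1/fact : ℕ → ℚ
1/fact n = (+ 1 / (n !)) {{n !≢0}}

-- The series e^{at}.
exp : ℚ → Series
exp a n = (a ^ℚ n) * 1/fact n

-- The coefficients n, n−1, …, 0 of f⁻¹, in this order, for f(0) ≠ 0.
recipCoeffs : (f : Series) .{{_ : NonZero (f 0)}} → (n : ℕ) → Vec ℚ (suc n)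
recipCoeffs f zero    = 1/ f 0 ∷ []
recipCoeffs f (suc n) =
  - (1/ f 0 * sum (λ i → f (suc (toℕ i)) * lookup (recipCoeffs f n) i)) ∷ recipCoeffs f n

recip : (f : Series) .{{_ : NonZero (f 0)}} → Series
recip f n = lookup (recipCoeffs f n) zero

lookup-recipCoeffs : ∀ f .{{_ : NonZero (f 0)}} n (i : Fin (suc n)) →
                     lookup (recipCoeffs f n) i ≡ recip f (n ∸ toℕ i)
lookup-recipCoeffs f n       zero    = refl
lookup-recipCoeffs f (suc n) (suc i) = lookup-recipCoeffs f n i

⊛-recip : ∀ f .{{_ : NonZero (f 0)}} → f ⊛ recip f ≗ const 1ℚ
⊛-recip f zero    = trans (+-identityʳ _) (*-inverseʳ (f 0))
⊛-recip f (suc n) = begin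
  f 0 * - (1/ f 0 * S) + sum (λ (i : Fin (suc n)) → f (suc (toℕ i)) * recip f (n ∸ toℕ i))
    ≡⟨ cong (λ x → f 0 * - (1/ f 0 * S) + x)
            (sum-cong-≗ (λ (i : Fin (suc n)) → cong (f (suc (toℕ i)) *_) (sym (lookup-recipCoeffs f n i)))) ⟩
  f 0 * - (1/ f 0 * S) + S     ≡⟨ cong (_+ S) (neg-distribʳ-* (f 0) (1/ f 0 * S)) ⟨
  - (f 0 * (1/ f 0 * S)) + S   ≡⟨ cong (λ x → - x + S) (*-assoc (f 0) (1/ f 0) S) ⟨
  - (f 0 * 1/ f 0 * S) + S     ≡⟨ cong (λ x → - (x * S) + S) (*-inverseʳ (f 0)) ⟩
  - (1ℚ * S) + S               ≡⟨ cong (λ x → - x + S) (*-identityˡ S) ⟩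
  - S + S                      ≡⟨ +-inverseˡ S ⟩
  0ℚ                           ∎
  where
  S : ℚ
  S = sum (λ i → f (suc (toℕ i)) * lookup (recipCoeffs f n) i)

_⊘_ : (f g : Series) .{{_ : NonZero (g 0)}} → Series
f ⊘ g = f ⊛ recip g

-- The Euler numbers: Σₖ E(k) tᵏ/k! = 2 / (eᵗ + e⁻ᵗ).
E : ℕ → ℚ
E k = fromℕ (k !) * (const (fromℕ 2) ⊘ (exp 1ℚ ⊕ exp (- 1ℚ))) k

n*1/n : ∀ n .{{_ : ℕ.NonZero n}} → fromℕ n * (+ 1 / n) ≡ 1ℚ
n*1/n n@(suc m) = toℚᵘ-injective
  (ℚᵘ.≃-trans (toℚᵘ-homo-* (fromℕ n) (+ 1 / n))
  (ℚᵘ.≃-trans (ℚᵘ.*-cong (toℚᵘ-fromℚᵘ (mkℚᵘ (+ n) 0)) (toℚᵘ-fromℚᵘ (mkℚᵘ (+ 1) m)))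
  (*≡* (trans (ℤ.*-identityʳ _) (trans (ℤ.*-identityʳ _)
    (sym (trans (ℤ.*-identityˡ _) (cong (λ k → + suc k) (ℕ-+-identityʳ m)))))))))

E-generatingFunction :
  (exp 1ℚ ⊕ exp (- 1ℚ)) ⊛ (λ k → E k * 1/fact k) ≗ const (fromℕ 2)
E-generatingFunction n = begin
  (g ⊛ (λ k → E k * 1/fact k)) n
    ≡⟨ sum-cong-≗ (λ (i : Fin (suc n)) → cong (g (toℕ i) *_) (E/fact (n ∸ toℕ i))) ⟩
  sum (λ (i : Fin (suc n)) → g (toℕ i) * (2ℚ * recip g (n ∸ toℕ i)))
    ≡⟨ sum-cong-≗ (λ (i : Fin (suc n)) → swap (g (toℕ i)) 2ℚ (recip g (n ∸ toℕ i))) ⟩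
  sum (λ (i : Fin (suc n)) → 2ℚ * (g (toℕ i) * recip g (n ∸ toℕ i)))
    ≡⟨ *-distribˡ-sum {suc n} 2ℚ (λ i → g (toℕ i) * recip g (n ∸ toℕ i)) ⟨
  2ℚ * (g ⊛ recip g) n     ≡⟨ cong (2ℚ *_) (⊛-recip g n) ⟩
  2ℚ * const 1ℚ n          ≡⟨ 2*const n ⟩
  const 2ℚ n               ∎
  where
  g : Series
  g = exp 1ℚ ⊕ exp (- 1ℚ)

  2ℚ : ℚ
  2ℚ = fromℕ 2

  2*const : ∀ n → 2ℚ * const 1ℚ n ≡ const 2ℚ n
  2*const zero    = refl
  2*const (suc _) = refl

  swap : ∀ x y z → x * (y * z) ≡ y * (x * z)
  swap x y z = trans (sym (*-assoc x y z)) (trans (cong (_* z) (*-comm x y)) (*-assoc y x z))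

  const-⊛ : ∀ a (f : Series) n → (const a ⊛ f) n ≡ a * f n
  const-⊛ a f n = begin
    a * f n + sum (λ (i : Fin n) → 0ℚ * f (n ∸ suc (toℕ i)))
      ≡⟨ cong (λ x → a * f n + x) (*-distribˡ-sum {n} 0ℚ (λ i → f (n ∸ suc (toℕ i)))) ⟨
    a * f n + 0ℚ * sum (λ (i : Fin n) → f (n ∸ suc (toℕ i)))
      ≡⟨ cong (λ x → a * f n + x) (*-zeroˡ (sum (λ (i : Fin n) → f (n ∸ suc (toℕ i))))) ⟩
    a * f n + 0ℚ   ≡⟨ +-identityʳ (a * f n) ⟩
    a * f n        ∎

  fact*1/fact : ∀ k → fromℕ (k !) * 1/fact k ≡ 1ℚ
  fact*1/fact k = n*1/n (k !) {{k !≢0}}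

  E/fact : ∀ k → E k * 1/fact k ≡ 2ℚ * recip g k
  E/fact k = begin
    E k * 1/fact k                                     ≡⟨ *-comm (E k) (1/fact k) ⟩
    1/fact k * (fromℕ (k !) * q)                       ≡⟨ *-assoc (1/fact k) (fromℕ (k !)) q ⟨
    1/fact k * fromℕ (k !) * q                         ≡⟨ cong (_* q) (*-comm (1/fact k) (fromℕ (k !))) ⟩
    fromℕ (k !) * 1/fact k * q                         ≡⟨ cong (_* q) (fact*1/fact k) ⟩
    1ℚ * q                                             ≡⟨ *-identityˡ q ⟩
    q                                                  ≡⟨ const-⊛ 2ℚ (recip g) k ⟩
    2ℚ * recip g k                                     ∎
    where
    q : ℚ
    q = (const 2ℚ ⊘ g) k

det : ∀ {n} → (Fin n → Fin n → ℚ) → ℚ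
det {zero}  M = 1ℚ
det {suc n} M =
  sum λ j → ((- 1ℚ) ^ℚ toℕ j) * (M zero j * det (λ i k → M (suc i) (punchIn j k)))

-- The matrix has order n + 1: its indices run over 0, …, n.
H : ℕ → (ℕ → ℚ) → ℚ
H n c = det {suc n} (λ i j → c (toℕ i ℕ.+ toℕ j))

{-# OPTIONS --safe #-}
module Submission where

-- Let L(yᵏ) = (2k + 1) E(2k), so that the matrix is L(yⁱ yʲ), and let s(t) = t sech t, so that
-- L(p) is the value at t = 0 of p(D²) D s, where D = d/dt.  From (eᵗ + e⁻ᵗ) s = 2t and the identity
--   R(x + 1) + R(x − 1) = 2 x ∏_{l<j} (x² − (2l+1)²),   R(x) = x ∏_{l=1}^{j} (x² − (2l)²),
-- one reads off L(∏_{l<j} (y − (2l+1)²)) = R′(0) = (−4)ʲ j!².  Column operations replace yʲ first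
-- by these products and then, through weighted differences, by the monic orthogonal polynomials
-- of L.  Their three-term recurrence shows that the resulting matrix is lower triangular with
-- diagonal entries 16ᵐ m!⁴.

open import Defs

module HankelOfEuler where

  open import Algebra.Bundles using (CommutativeRing)
  open import Data.Fin.Base using (Fin; zero; suc; toℕ; fromℕ<; inject₁; punchIn; punchOut)
  open import Data.Fin.Properties
    using (toℕ<n; toℕ-injective; toℕ-fromℕ<; toℕ-inject₁; suc-injective;
           punchInᵢ≢i; punchIn-injective; punchIn-punchOut)
    renaming (_≟_ to _≟ᶠ_)
  import Data.Integer.Base as ℤ
  import Data.Integer.Properties as ℤ
  open import Data.List.Base using (applyUpTo; map; upTo; _∷_; []; _∷ʳ_)
  open import Data.List.Properties using (map-upTo; applyUpTo-∷ʳ)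
  open import Data.Nat.Base as ℕ using (ℕ; zero; suc; _∸_; _!)
  open import Data.Nat.ListAction using (product)
  open import Data.Nat.ListAction.Properties using (product-++)
  import Data.Nat.Properties as ℕ
  import Data.Nat.Tactic.RingSolver as ℕ-ring
  open import Data.Product.Base using (∃; _×_; _,_)
  open import Data.Rational.Base
  open import Data.Rational.Properties
  import Data.Rational.Unnormalised.Base as ℚᵘ
  import Data.Rational.Unnormalised.Properties as ℚᵘ
  open import Data.Sum.Base using (_⊎_; inj₁; inj₂)
  open import Function.Base using (_∘_)
  open import Relation.Binary.PropositionalEquality
  open import Relation.Nullary.Decidable using (yes; no; dec⇒maybe)
  open import Relation.Nullary.Negation using (contradiction)
  open import Tactic.RingSolver using (solve-∀)
  open import Tactic.RingSolver.Core.AlmostCommutativeRing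
    using (AlmostCommutativeRing; fromCommutativeRing)
  open import Algebra.Properties.Semiring.Mult (CommutativeRing.semiring +-*-commutativeRing)
    using (×-homo-+; ×1-homo-*) renaming (_×_ to _×ℚ_)
  open import Algebra.Properties.Semiring.Sum (CommutativeRing.semiring +-*-commutativeRing)
    using (∑-distrib-+; sum-replicate-zero)
  open ≡-Reasoning

  ℚ-ring : AlmostCommutativeRing _ _
  ℚ-ring = fromCommutativeRing +-*-commutativeRing λ x → dec⇒maybe (0ℚ ≟ x)

  -- Determinants under elementary column operations.

  Matrix : ℕ → Set
  Matrix n = Fin n → Fin n → ℚ

  minor : ∀ {n} → Matrix (suc n) → Fin (suc n) → Matrix n
  minor M j i k = M (suc i) (punchIn j k)

  sum-zero : ∀ {n} (t : Fin n → ℚ) → (∀ i → t i ≡ 0ℚ) → sum t ≡ 0ℚ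
  sum-zero {n} t t≡0 = trans (sum-cong-≗ t≡0) (sum-replicate-zero n)

  det-cong : ∀ {n} {M N : Matrix n} → (∀ i j → M i j ≡ N i j) → det M ≡ det N
  det-cong {zero}  M≡N = refl
  det-cong {suc n} M≡N = sum-cong-≗ λ j →
    cong (((- 1ℚ) ^ℚ toℕ j) *_)
      (cong₂ _*_ (M≡N zero j) (det-cong λ i k → M≡N (suc i) (punchIn j k)))

  -- Expand along the first row. For j = k the minors omit column k and coincide, so only the entry
  -- splits. For j ≠ k the entry is shared and column k sits in the minor at `punchOut j≢k`, where
  -- induction applies.
  det-+ : ∀ {n} (k : Fin n) (r : ℚ) {A B C : Matrix n} →
          (∀ i j → j ≢ k → A i j ≡ B i j) → (∀ i j → j ≢ k → C i j ≡ B i j) →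
          (∀ i → A i k ≡ B i k + r * C i k) →
          det A ≡ det B + r * det C
  det-+ {suc n} k r {A} {B} {C} A≡B C≡B Aₖ = begin
    sum (term A)                                ≡⟨ sum-cong-≗ step ⟩
    sum (λ j → term B j + r * term C j)         ≡⟨ ∑-distrib-+ (term B) (λ j → r * term C j) ⟩
    sum (term B) + sum (λ j → r * term C j)     ≡⟨ cong (sum (term B) +_) (*-distribˡ-sum r (term C)) ⟨
    sum (term B) + r * sum (term C)             ∎
    where
    term : Matrix (suc n) → Fin (suc n) → ℚ
    term M j = ((- 1ℚ) ^ℚ toℕ j) * (M zero j * det (minor M j))

    entry : ∀ s b c d r → s * ((b + r * c) * d) ≡ s * (b * d) + r * (s * (c * d))
    entry = solve-∀ ℚ-ring

    cofactor : ∀ s b c d r → s * (b * (c + r * d)) ≡ s * (b * c) + r * (s * (b * d))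
    cofactor = solve-∀ ℚ-ring

    step : ∀ j → term A j ≡ term B j + r * term C j
    step j with j ≟ᶠ k
    ... | yes refl = begin
      s * (A zero j * det (minor A j))
        ≡⟨ cong₂ (λ x y → s * (x * y)) (Aₖ zero)
             (det-cong λ i l → A≡B (suc i) (punchIn j l) (punchInᵢ≢i j l)) ⟩
      s * ((B zero j + r * C zero j) * det (minor B j))
        ≡⟨ entry s (B zero j) (C zero j) (det (minor B j)) r ⟩
      term B j + r * (s * (C zero j * det (minor B j)))
        ≡⟨ cong (λ x → term B j + r * (s * (C zero j * x)))
             (det-cong λ i l → C≡B (suc i) (punchIn j l) (punchInᵢ≢i j l)) ⟨
      term B j + r * term C j ∎
      where s = (- 1ℚ) ^ℚ toℕ j
    ... | no j≢k = begin
      s * (A zero j * det (minor A j))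
        ≡⟨ cong₂ (λ x y → s * (x * y)) (A≡B zero j j≢k)
             (det-+ (punchOut j≢k) r
               (λ i l l≢k → A≡B (suc i) (punchIn j l) (off l l≢k))
               (λ i l l≢k → C≡B (suc i) (punchIn j l) (off l l≢k))
               (λ i → subst (λ l → A (suc i) l ≡ B (suc i) l + r * C (suc i) l)
                            (sym (punchIn-punchOut j≢k)) (Aₖ (suc i)))) ⟩
      s * (B zero j * (det (minor B j) + r * det (minor C j)))
        ≡⟨ cofactor s (B zero j) (det (minor B j)) (det (minor C j)) r ⟩
      term B j + r * (s * (B zero j * det (minor C j)))
        ≡⟨ cong (λ x → term B j + r * (s * (x * det (minor C j)))) (C≡B zero j j≢k) ⟨
      term B j + r * term C j ∎
      where
      s = (- 1ℚ) ^ℚ toℕ j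
      off : ∀ l → l ≢ punchOut j≢k → punchIn j l ≢ k
      off l l≢ eq = l≢ (punchIn-injective j l _ (trans eq (sym (punchIn-punchOut j≢k))))

  sum-adjacent : ∀ {n} (k : Fin n) (t : Fin (suc n) → ℚ) →
                 (∀ j → j ≢ inject₁ k → j ≢ suc k → t j ≡ 0ℚ) →
                 t (suc k) ≡ - t (inject₁ k) → sum t ≡ 0ℚ
  sum-adjacent zero t t≡0 opp = begin
    t zero + (t (suc zero) + sum (λ i → t (suc (suc i))))
      ≡⟨ cong₂ (λ x y → t zero + (x + y)) opp
           (sum-zero (λ i → t (suc (suc i))) λ i → t≡0 (suc (suc i)) (λ ()) (λ ())) ⟩
    t zero + (- t zero + 0ℚ)   ≡⟨ cong (t zero +_) (+-identityʳ (- t zero)) ⟩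
    t zero - t zero            ≡⟨ +-inverseʳ (t zero) ⟩
    0ℚ                         ∎
  sum-adjacent (suc k) t t≡0 opp = begin
    t zero + sum (t ∘ suc)   ≡⟨ cong₂ _+_ (t≡0 zero (λ ()) (λ ()))
                                  (sum-adjacent k (t ∘ suc)
                                    (λ j j≢ j≢′ → t≡0 (suc j) (j≢ ∘ suc-injective) (j≢′ ∘ suc-injective)) opp) ⟩
    0ℚ + 0ℚ                  ≡⟨⟩
    0ℚ                       ∎

  -- Serves to compare the minors that delete one of two equal adjacent columns: wherever they pick
  -- different columns, they pick the two equal ones.
  punchIn-adjacent : ∀ {n} (k l : Fin n) →
    punchIn (inject₁ k) l ≡ punchIn (suc k) l ⊎
    (punchIn (inject₁ k) l ≡ suc k × punchIn (suc k) l ≡ inject₁ k)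
  punchIn-adjacent zero    zero    = inj₂ (refl , refl)
  punchIn-adjacent zero    (suc l) = inj₁ refl
  punchIn-adjacent (suc k) zero    = inj₁ refl
  punchIn-adjacent (suc k) (suc l) with punchIn-adjacent k l
  ... | inj₁ eq         = inj₁ (cong suc eq)
  ... | inj₂ (eq , eq′) = inj₂ (cong suc eq , cong suc eq′)

  -- Deleting any other column keeps the two columns adjacent, so induction in `det-adjacent`
  -- applies to the minor.
  punchIn-avoids : ∀ {n} (k : Fin (suc n)) (j : Fin (suc (suc n))) → j ≢ inject₁ k → j ≢ suc k →
    ∃ λ l → punchIn j (inject₁ l) ≡ inject₁ k × punchIn j (suc l) ≡ suc k
  punchIn-avoids zero          zero           j≢ j≢′ = contradiction refl j≢
  punchIn-avoids zero          (suc zero)     j≢ j≢′ = contradiction refl j≢′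
  punchIn-avoids {suc n} zero  (suc (suc j))  j≢ j≢′ = zero , refl , refl
  punchIn-avoids (suc k)       zero           j≢ j≢′ = k , refl , refl
  punchIn-avoids {suc n} (suc k) (suc j)      j≢ j≢′
    with punchIn-avoids k j (j≢ ∘ cong suc) (j≢′ ∘ cong suc)
  ... | l , eq , eq′ = suc l , cong suc eq , cong suc eq′

  -- In the expansion along the first row, minors that keep both equal columns vanish by induction;
  -- the two remaining minors are equal and carry opposite signs.
  det-adjacent : ∀ {n} (k : Fin n) (M : Matrix (suc n)) →
                 (∀ i → M i (inject₁ k) ≡ M i (suc k)) → det M ≡ 0ℚ
  det-adjacent {suc n} k M Mₖ = sum-adjacent k term vanish cancel
    where
    term : Fin (suc (suc n)) → ℚ
    term j = ((- 1ℚ) ^ℚ toℕ j) * (M zero j * det (minor M j))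

    vanish : ∀ j → j ≢ inject₁ k → j ≢ suc k → term j ≡ 0ℚ
    vanish j j≢ j≢′ with l , eq , eq′ ← punchIn-avoids k j j≢ j≢′ = begin
      s * (M zero j * det (minor M j))
        ≡⟨ cong (λ x → s * (M zero j * x)) (det-adjacent l (minor M j) λ i →
             trans (cong (M (suc i)) eq) (trans (Mₖ (suc i)) (cong (M (suc i)) (sym eq′)))) ⟩
      s * (M zero j * 0ℚ)   ≡⟨ cong (s *_) (*-zeroʳ (M zero j)) ⟩
      s * 0ℚ                ≡⟨ *-zeroʳ s ⟩
      0ℚ                    ∎
      where s = (- 1ℚ) ^ℚ toℕ j

    same : ∀ i l → minor M (suc k) i l ≡ minor M (inject₁ k) i l
    same i l with punchIn-adjacent k l
    ... | inj₁ eq         = cong (M (suc i)) (sym eq)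
    ... | inj₂ (eq , eq′) =
      trans (cong (M (suc i)) eq′) (trans (Mₖ (suc i)) (cong (M (suc i)) (sym eq)))

    flip : ∀ s x → (- 1ℚ * s) * x ≡ - (s * x)
    flip = solve-∀ ℚ-ring

    cancel : term (suc k) ≡ - term (inject₁ k)
    cancel = begin
      (- 1ℚ * s) * (M zero (suc k) * det (minor M (suc k)))
        ≡⟨ cong₂ (λ x y → (- 1ℚ * s) * (x * y)) (sym (Mₖ zero)) (det-cong same) ⟩
      (- 1ℚ * s) * (M zero (inject₁ k) * det (minor M (inject₁ k)))
        ≡⟨ flip s _ ⟩
      - (s * (M zero (inject₁ k) * det (minor M (inject₁ k))))
        ≡⟨ cong (λ m → - (((- 1ℚ) ^ℚ m) * (M zero (inject₁ k) * det (minor M (inject₁ k)))))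
             (sym (toℕ-inject₁ k)) ⟩
      - term (inject₁ k) ∎
      where s = (- 1ℚ) ^ℚ toℕ k

  det-addColumn : ∀ {n} (k : Fin n) (r : ℚ) {A B : Matrix (suc n)} →
                  (∀ i j → j ≢ suc k → A i j ≡ B i j) →
                  (∀ i → A i (suc k) ≡ B i (suc k) + r * B i (inject₁ k)) →
                  det A ≡ det B
  det-addColumn {n} k r {A} {B} A≡B Aₖ = begin
    det A
      ≡⟨ det-+ (suc k) r A≡B C≡B (λ i →
           trans (Aₖ i) (cong (λ x → B i (suc k) + r * x) (sym (Cₖ i)))) ⟩
    det B + r * det C
      ≡⟨ cong (λ x → det B + r * x) (det-adjacent k C λ i →
           trans (C≡B i (inject₁ k) (inject₁≢suc k)) (sym (Cₖ i))) ⟩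
    det B + r * 0ℚ      ≡⟨ cong (det B +_) (*-zeroʳ r) ⟩
    det B + 0ℚ          ≡⟨ +-identityʳ (det B) ⟩
    det B               ∎
    where
    -- `C` is `B` with column k + 1 overwritten by column k: two equal neighbours, so the term that
    -- linearity adds vanishes.
    C : Matrix (suc n)
    C i j with j ≟ᶠ suc k
    ... | yes _ = B i (inject₁ k)
    ... | no  _ = B i j

    C≡B : ∀ i j → j ≢ suc k → C i j ≡ B i j
    C≡B i j j≢ with j ≟ᶠ suc k
    ... | yes j≡ = contradiction j≡ j≢
    ... | no  _  = refl

    Cₖ : ∀ i → C i (suc k) ≡ B i (inject₁ k)
    Cₖ i with suc k ≟ᶠ suc k
    ... | yes _  = refl
    ... | no  k≢ = contradiction refl k≢

    inject₁≢suc : ∀ {m} (j : Fin m) → inject₁ j ≢ suc j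
    inject₁≢suc (suc j) eq = inject₁≢suc j (suc-injective eq)

  -- Bidiagonal column operations and triangular arrays.

  -- One row times a unit upper bidiagonal matrix. Rows are sequences on ℕ, so that reindexing is
  -- free of `Fin` bounds; `columns` truncates them.
  bidiagonal : (ℕ → ℚ) → (ℕ → ℚ) → ℕ → ℚ
  bidiagonal r x zero    = x zero
  bidiagonal r x (suc j) = x (suc j) + r j * x j

  zeroBelow : ℕ → (ℕ → ℚ) → ℕ → ℚ
  zeroBelow zero    r j       = r j
  zeroBelow (suc m) r zero    = 0ℚ
  zeroBelow (suc m) r (suc j) = zeroBelow m (r ∘ suc) j

  zeroBelow-< : ∀ {m j} r → j ℕ.< m → zeroBelow m r j ≡ 0ℚ
  zeroBelow-< {suc m} {zero}  r _   = refl
  zeroBelow-< {suc m} {suc j} r j<m = zeroBelow-< (r ∘ suc) (ℕ.s<s⁻¹ j<m)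

  zeroBelow-≢ : ∀ {m j} r → j ≢ m → zeroBelow m r j ≡ zeroBelow (suc m) r j
  zeroBelow-≢ {zero}  {zero}  r j≢m = contradiction refl j≢m
  zeroBelow-≢ {zero}  {suc j} r j≢m = refl
  zeroBelow-≢ {suc m} {zero}  r j≢m = refl
  zeroBelow-≢ {suc m} {suc j} r j≢m = zeroBelow-≢ (r ∘ suc) (j≢m ∘ cong suc)

  columns : ∀ {n} → (Fin n → ℕ → ℚ) → Matrix n
  columns x i j = x i (toℕ j)

  bidiagonal-zeroBelow-< : ∀ {m j} r x → j ℕ.≤ m → bidiagonal (zeroBelow m r) x j ≡ x j
  bidiagonal-zeroBelow-< {m} {zero}  r x j≤m = refl
  bidiagonal-zeroBelow-< {m} {suc j} r x j<m = begin
    x (suc j) + zeroBelow m r j * x j   ≡⟨ cong (λ y → x (suc j) + y * x j) (zeroBelow-< r j<m) ⟩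
    x (suc j) + 0ℚ * x j           ≡⟨ cong (x (suc j) +_) (*-zeroˡ (x j)) ⟩
    x (suc j) + 0ℚ                 ≡⟨ +-identityʳ (x (suc j)) ⟩
    x (suc j)                      ∎

  bidiagonal-zeroBelow-≢ : ∀ {m j} r x → j ≢ suc m →
    bidiagonal (zeroBelow m r) x j ≡ bidiagonal (zeroBelow (suc m) r) x j
  bidiagonal-zeroBelow-≢ {m} {zero}  r x j≢ = refl
  bidiagonal-zeroBelow-≢ {m} {suc j} r x j≢ =
    cong (λ y → x (suc j) + y * x j) (zeroBelow-≢ r (j≢ ∘ cong suc))

  -- `stage m` performs only the additions with coefficients r j, j ≥ m. It arises from
  -- `stage (suc m)` by one addition into column m + 1, whose source, column m, is still unmodified
  -- there. `stage 0` is the full operation, and `stage n` leaves all n + 1 columns as they were.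
  det-bidiagonal : ∀ {n} (r : ℕ → ℚ) (x : Fin n → ℕ → ℚ) →
                   det (columns (λ i → bidiagonal r (x i))) ≡ det (columns x)
  det-bidiagonal {zero}  r x = refl
  det-bidiagonal {suc n} r x = begin
    det (stage 0)     ≡⟨ descend n ℕ.≤-refl ⟩
    det (stage n)     ≡⟨ det-cong (λ i j → bidiagonal-zeroBelow-< r (x i) (ℕ.s≤s⁻¹ (toℕ<n j))) ⟩
    det (columns x)   ∎
    where
    stage : ℕ → Matrix (suc n)
    stage m = columns (λ i → bidiagonal (zeroBelow m r) (x i))

    zeroBelow-≡ : ∀ m (s : ℕ → ℚ) → zeroBelow m s m ≡ s m
    zeroBelow-≡ zero    s = refl
    zeroBelow-≡ (suc m) s = zeroBelow-≡ m (s ∘ suc)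

    step : ∀ m → m ℕ.< n → det (stage m) ≡ det (stage (suc m))
    step m m<n = det-addColumn k (r m)
      (λ i j j≢ → bidiagonal-zeroBelow-≢ r (x i) (λ eq →
        j≢ (toℕ-injective (trans eq (cong suc (sym (toℕ-fromℕ< m<n)))))))
      (λ i → begin
        bidiagonal (zeroBelow m r) (x i) (suc (toℕ k))
          ≡⟨ cong (λ l → bidiagonal (zeroBelow m r) (x i) (suc l)) k≡m ⟩
        x i (suc m) + zeroBelow m r m * x i m
          ≡⟨ cong (λ y → x i (suc m) + y * x i m) (zeroBelow-≡ m r) ⟩
        x i (suc m) + r m * x i m
          ≡⟨ cong₂ (λ y z → y + r m * z)
               (bidiagonal-zeroBelow-< r (x i) (ℕ.≤-refl {suc m}))
               (bidiagonal-zeroBelow-< r (x i) (ℕ.n≤1+n m)) ⟨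
        x′ i (suc m) + r m * x′ i m
          ≡⟨ cong₂ (λ a b → x′ i (suc a) + r m * x′ i b) k≡m (trans (toℕ-inject₁ k) k≡m) ⟨
        stage (suc m) i (suc k) + r m * stage (suc m) i (inject₁ k) ∎)
      where
      k : Fin n
      k = fromℕ< m<n
      k≡m : toℕ k ≡ m
      k≡m = toℕ-fromℕ< m<n
      x′ : Fin (suc n) → ℕ → ℚ
      x′ i = bidiagonal (zeroBelow (suc m) r) (x i)

    descend : ∀ m → m ℕ.≤ n → det (stage 0) ≡ det (stage m)
    descend zero    _   = refl
    descend (suc m) m<n = trans (descend m (ℕ.<⇒≤ m<n)) (step m m<n)

  -- The path through the array z that goes down its left edge z 0 0, ..., z m 0 and then along
  -- level m: z m 1, z m 2, and so on.
  partial : (ℕ → ℕ → ℚ) → ℕ → ℕ → ℚ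
  partial z zero    j       = z 0 j
  partial z (suc m) zero    = z 0 0
  partial z (suc m) (suc j) = partial (z ∘ suc) m j

  -- Columns up to m are final. Each column j + 1 with j ≥ m rises from level m to level m + 1 by
  -- the recursion at k = j - m, which is where the index `j ∸ m` comes from.
  partial-suc : ∀ (z r : ℕ → ℕ → ℚ) → (∀ m k → z (suc m) k ≡ z m (suc k) + r m k * z m k) →
                ∀ m j → partial z (suc m) j ≡ bidiagonal (zeroBelow m (λ j → r m (j ∸ m))) (partial z m) j
  partial-suc z r rec zero    zero          = refl
  partial-suc z r rec zero    (suc j)       = rec 0 j
  partial-suc z r rec (suc m) zero          = refl
  -- After the shift this is column 0, which `bidiagonal` leaves without a second summand; the
  -- summand with coefficient 0 is supplied by hand.
  partial-suc z r rec (suc m) (suc zero)    = begin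
    partial (z ∘ suc) (suc m) 0                 ≡⟨ partial-suc (z ∘ suc) (r ∘ suc) (rec ∘ suc) m 0 ⟩
    partial (z ∘ suc) m 0                       ≡⟨ +-identityʳ _ ⟨
    partial (z ∘ suc) m 0 + 0ℚ                  ≡⟨ cong (partial (z ∘ suc) m 0 +_) (*-zeroˡ (z 0 0)) ⟨
    partial (z ∘ suc) m 0 + 0ℚ * z 0 0          ∎
  partial-suc z r rec (suc m) (suc (suc j)) = partial-suc (z ∘ suc) (r ∘ suc) (rec ∘ suc) m (suc j)

  partial-≤ : ∀ z {m j} → j ℕ.≤ m → partial z m j ≡ z j 0
  partial-≤ z {zero}  {zero}  _   = refl
  partial-≤ z {suc m} {zero}  _   = refl
  partial-≤ z {suc m} {suc j} j≤m = partial-≤ (z ∘ suc) (ℕ.s≤s⁻¹ j≤m)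

  -- The coefficients r are the same for all rows i, so each passage to the next level is a column
  -- operation. After n of them every column lies on the left edge.
  det-triangle : ∀ {n} (z : Fin n → ℕ → ℕ → ℚ) (r : ℕ → ℕ → ℚ) →
                 (∀ i m k → z i (suc m) k ≡ z i m (suc k) + r m k * z i m k) →
                 det (columns λ i → z i 0) ≡ det (columns λ i j → z i j 0)
  det-triangle {n} z r rec = begin
    det (columns λ i → z i 0)           ≡⟨ stages n ⟩
    det (columns λ i → partial (z i) n) ≡⟨ det-cong (λ i j → partial-≤ (z i) (ℕ.<⇒≤ (toℕ<n j))) ⟩
    det (columns λ i j → z i j 0)       ∎
    where
    stages : ∀ m → det (columns λ i → z i 0) ≡ det (columns λ i → partial (z i) m)
    stages zero    = refl
    stages (suc m) = begin
      det (columns λ i → z i 0)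
        ≡⟨ stages m ⟩
      det (columns λ i → partial (z i) m)
        ≡⟨ det-bidiagonal (zeroBelow m (λ j → r m (j ∸ m))) (λ i → partial (z i) m) ⟨
      det (columns λ i → bidiagonal (zeroBelow m (λ j → r m (j ∸ m))) (partial (z i) m))
        ≡⟨ det-cong (λ i j → partial-suc (z i) r (rec i) m (toℕ j)) ⟨
      det (columns λ i → partial (z i) (suc m)) ∎

  -- The cast from ℕ to ℚ, and lower triangular determinants.

  -- `fromℕ` normalises a fraction and does not compute on a variable, so the equation is checked on
  -- unnormalised rationals.
  fromℕ-suc : ∀ n → fromℕ (suc n) ≡ 1ℚ + fromℕ n
  fromℕ-suc n = toℚᵘ-injective
    (ℚᵘ.≃-trans (normal (suc n))
    (ℚᵘ.≃-trans (ℚᵘ.*≡* (cong (λ x → (ℤ.1ℤ ℤ.+ x) ℤ.* ℤ.1ℤ) (sym (ℤ.*-identityʳ (ℤ.+ n)))))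
    (ℚᵘ.≃-sym (ℚᵘ.≃-trans (toℚᵘ-homo-+ 1ℚ (fromℕ n)) (ℚᵘ.+-cong (ℚᵘ.≃-refl {toℚᵘ 1ℚ}) (normal n))))))
    where
    normal : ∀ n → toℚᵘ (fromℕ n) ℚᵘ.≃ ℚᵘ.mkℚᵘ (ℤ.+ n) 0
    normal n = toℚᵘ-fromℚᵘ (ℚᵘ.mkℚᵘ (ℤ.+ n) 0)

  -- Unlike fromℕ, this cast satisfies ι (suc n) = 1ℚ + ι n definitionally.
  ι : ℕ → ℚ
  ι n = n ×ℚ 1ℚ

  fromℕ≡ι : ∀ n → fromℕ n ≡ ι n
  fromℕ≡ι zero    = refl
  fromℕ≡ι (suc n) = trans (fromℕ-suc n) (cong (1ℚ +_) (fromℕ≡ι n))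

  fromℕ-+ : ∀ m n → fromℕ (m ℕ.+ n) ≡ fromℕ m + fromℕ n
  fromℕ-+ m n = begin
    fromℕ (m ℕ.+ n)     ≡⟨ fromℕ≡ι (m ℕ.+ n) ⟩
    ι (m ℕ.+ n)         ≡⟨ ×-homo-+ 1ℚ m n ⟩
    ι m + ι n           ≡⟨ cong₂ _+_ (fromℕ≡ι m) (fromℕ≡ι n) ⟨
    fromℕ m + fromℕ n   ∎

  fromℕ-* : ∀ m n → fromℕ (m ℕ.* n) ≡ fromℕ m * fromℕ n
  fromℕ-* m n = begin
    fromℕ (m ℕ.* n)     ≡⟨ fromℕ≡ι (m ℕ.* n) ⟩
    ι (m ℕ.* n)         ≡⟨ ×1-homo-* m n ⟩
    ι m * ι n           ≡⟨ cong₂ _*_ (fromℕ≡ι m) (fromℕ≡ι n) ⟨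
    fromℕ m * fromℕ n   ∎

  det-lower : ∀ {n} (l : ℕ → ℕ → ℚ) (d : ℕ → ℕ) →
              (∀ i j → i ℕ.< j → l i j ≡ 0ℚ) → (∀ i → l i i ≡ fromℕ (d i)) →
              det {n} (columns (l ∘ toℕ)) ≡ fromℕ (product (applyUpTo d n))
  det-lower {zero}  l d upper diag = refl
  det-lower {suc n} l d upper diag = begin
    term zero + sum (term ∘ suc)
      ≡⟨ cong (term zero +_) (sum-zero (term ∘ suc) λ j → begin
           s (suc j) * (l 0 (suc (toℕ j)) * m (suc j))
             ≡⟨ cong (λ x → s (suc j) * (x * m (suc j))) (upper 0 (suc (toℕ j)) ℕ.z<s) ⟩
           s (suc j) * (0ℚ * m (suc j))   ≡⟨ cong (s (suc j) *_) (*-zeroˡ (m (suc j))) ⟩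
           s (suc j) * 0ℚ                 ≡⟨ *-zeroʳ (s (suc j)) ⟩
           0ℚ                             ∎) ⟩
    term zero + 0ℚ   ≡⟨ +-identityʳ (term zero) ⟩
    term zero        ≡⟨ *-identityˡ (l 0 0 * m zero) ⟩
    l 0 0 * m zero
      ≡⟨ cong₂ _*_ (diag 0) (det-lower {n} (λ i j → l (suc i) (suc j)) (d ∘ suc)
           (λ i j i<j → upper (suc i) (suc j) (ℕ.s<s i<j)) (diag ∘ suc)) ⟩
    fromℕ (d 0) * fromℕ (product (applyUpTo (d ∘ suc) n))
      ≡⟨ fromℕ-* (d 0) _ ⟨
    fromℕ (product (applyUpTo d (suc n))) ∎
    where
    s m term : Fin (suc n) → ℚ
    s j = (- 1ℚ) ^ℚ toℕ j
    m j = det (minor (columns {suc n} (l ∘ toℕ)) j)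
    term j = s j * (l 0 (toℕ j) * m j)

  -- Exponential generating functions; multiplication by e^{at} and by t.

  shift : (ℕ → ℚ) → ℕ → ℚ
  shift s n = s (suc n)

  -- The operator t d/dt, a derivation of `⊛` that keeps the index in place, unlike d/dt.
  θ : (ℕ → ℚ) → ℕ → ℚ
  θ s n = fromℕ n * s n

  egf : (ℕ → ℚ) → Series
  egf s n = s n * 1/fact n

  1/fact-suc : ∀ n → fromℕ (suc n) * 1/fact (suc n) ≡ 1/fact n
  1/fact-suc n = begin
    q * v                        ≡⟨ *-identityʳ (q * v) ⟨
    q * v * 1ℚ                   ≡⟨ cong (q * v *_) (n*1/n (n !) {{n ℕ.!≢0}}) ⟨
    q * v * (p * u)              ≡⟨ rearrange q v p u ⟩
    q * p * v * u                ≡⟨ cong (λ x → x * v * u) (fromℕ-* (suc n) (n !)) ⟨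
    fromℕ (suc n !) * v * u ≡⟨ cong (_* u) (n*1/n (suc n !) {{suc n ℕ.!≢0}}) ⟩
    1ℚ * u                       ≡⟨ *-identityˡ u ⟩
    u                            ∎
    where
    q = fromℕ (suc n)
    p = fromℕ (n !)
    u = 1/fact n
    v = 1/fact (suc n)
    rearrange : ∀ q v p u → q * v * (p * u) ≡ q * p * v * u
    rearrange = solve-∀ ℚ-ring

  egf-θ : ∀ s n → θ (egf s) (suc n) ≡ egf (shift s) n
  egf-θ s n = begin
    q * (x * v)   ≡⟨ rearrange q x v ⟩
    x * (q * v)   ≡⟨ cong (x *_) (1/fact-suc n) ⟩
    x * 1/fact n  ∎
    where
    q = fromℕ (suc n)
    x = s (suc n)
    v = 1/fact (suc n)
    rearrange : ∀ q x v → q * (x * v) ≡ x * (q * v)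
    rearrange = solve-∀ ℚ-ring

  ⊛-cong : ∀ {f f′ g g′ : Series} → f ≗ f′ → g ≗ g′ → f ⊛ g ≗ f′ ⊛ g′
  ⊛-cong f≗ g≗ n = sum-cong-≗ λ (i : Fin (suc n)) → cong₂ _*_ (f≗ (toℕ i)) (g≗ (n ∸ toℕ i))

  ⊛-distribʳ : ∀ f g h n → ((f ⊕ g) ⊛ h) n ≡ (f ⊛ h) n + (g ⊛ h) n
  ⊛-distribʳ f g h n = trans
    (sum-cong-≗ λ (i : Fin (suc n)) → *-distribʳ-+ (h (n ∸ toℕ i)) (f (toℕ i)) (g (toℕ i)))
    (∑-distrib-+ {suc n} (λ i → f (toℕ i) * h (n ∸ toℕ i)) (λ i → g (toℕ i) * h (n ∸ toℕ i)))

  -- Leibniz rule: in the summand of index i the factor n splits as i + (n - i).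
  θ-⊛ : ∀ f g n → θ (f ⊛ g) n ≡ (θ f ⊛ g) n + (f ⊛ θ g) n
  θ-⊛ f g n = begin
    fromℕ n * sum (λ (i : Fin (suc n)) → f (toℕ i) * g (n ∸ toℕ i))
      ≡⟨ *-distribˡ-sum {suc n} (fromℕ n) (λ i → f (toℕ i) * g (n ∸ toℕ i)) ⟩
    sum (λ (i : Fin (suc n)) → fromℕ n * (f (toℕ i) * g (n ∸ toℕ i)))
      ≡⟨ sum-cong-≗ (λ (i : Fin (suc n)) → split i) ⟩
    sum (λ (i : Fin (suc n)) → θ f (toℕ i) * g (n ∸ toℕ i) + f (toℕ i) * θ g (n ∸ toℕ i))
      ≡⟨ ∑-distrib-+ {suc n} (λ i → θ f (toℕ i) * g (n ∸ toℕ i)) (λ i → f (toℕ i) * θ g (n ∸ toℕ i)) ⟩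
    (θ f ⊛ g) n + (f ⊛ θ g) n ∎
    where
    distrib : ∀ a b x y → (a + b) * (x * y) ≡ a * x * y + x * (b * y)
    distrib = solve-∀ ℚ-ring
    split : ∀ (i : Fin (suc n)) → fromℕ n * (f (toℕ i) * g (n ∸ toℕ i)) ≡
                    θ f (toℕ i) * g (n ∸ toℕ i) + f (toℕ i) * θ g (n ∸ toℕ i)
    split i = trans
      (cong (_* (f (toℕ i) * g (n ∸ toℕ i)))
        (trans (cong fromℕ (sym (ℕ.m+[n∸m]≡n (ℕ.s≤s⁻¹ (toℕ<n i))))) (fromℕ-+ (toℕ i) (n ∸ toℕ i))))
      (distrib (fromℕ (toℕ i)) _ (f (toℕ i)) _)

  ⊛-headˡ : ∀ f g n → f 0 ≡ 0ℚ → (f ⊛ g) (suc n) ≡ (shift f ⊛ g) n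
  ⊛-headˡ f g n f₀ = begin
    f 0 * g (suc n) + (shift f ⊛ g) n   ≡⟨ cong (λ x → x * g (suc n) + (shift f ⊛ g) n) f₀ ⟩
    0ℚ * g (suc n) + (shift f ⊛ g) n    ≡⟨ cong (_+ (shift f ⊛ g) n) (*-zeroˡ (g (suc n))) ⟩
    0ℚ + (shift f ⊛ g) n                ≡⟨ +-identityˡ _ ⟩
    (shift f ⊛ g) n                     ∎

  ⊛-headʳ : ∀ f g n → g 0 ≡ 0ℚ → (f ⊛ g) (suc n) ≡ (f ⊛ shift g) n
  ⊛-headʳ f g zero    g₀ = begin
    f 0 * g 1 + (f 1 * g 0 + 0ℚ)   ≡⟨ cong (λ x → f 0 * g 1 + (f 1 * x + 0ℚ)) g₀ ⟩
    f 0 * g 1 + (f 1 * 0ℚ + 0ℚ)    ≡⟨ cong (λ x → f 0 * g 1 + (x + 0ℚ)) (*-zeroʳ (f 1)) ⟩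
    f 0 * g 1 + 0ℚ                 ∎
  ⊛-headʳ f g (suc n) g₀ = cong (f 0 * g (suc (suc n)) +_) (⊛-headʳ (shift f) g n g₀)

  -- The coefficients, in the basis tⁿ/n!, of e^{at} times the series with coefficients s.
  expMul : ℚ → (ℕ → ℚ) → ℕ → ℚ
  expMul a s zero    = s zero
  expMul a s (suc n) = expMul a (λ k → s (suc k) + a * s k) n

  expMul-cong : ∀ a {s s′} → s ≗ s′ → expMul a s ≗ expMul a s′
  expMul-cong a s≗ zero    = s≗ zero
  expMul-cong a s≗ (suc n) =
    expMul-cong a (λ k → cong₂ (λ x y → x + a * y) (s≗ (suc k)) (s≗ k)) n

  expMul-linear : ∀ a r s u n →
    expMul a (λ k → s k + r * u k) n ≡ expMul a s n + r * expMul a u n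
  expMul-linear a r s u zero    = refl
  expMul-linear a r s u (suc n) = trans
    (expMul-cong a (λ k → rearrange a r (s (suc k)) (u (suc k)) (s k) (u k)) n)
    (expMul-linear a r (λ k → s (suc k) + a * s k) (λ k → u (suc k) + a * u k) n)
    where
    rearrange : ∀ a r s′ u′ s u →
      s′ + r * u′ + a * (s + r * u) ≡ s′ + a * s + r * (u′ + a * u)
    rearrange = solve-∀ ℚ-ring

  θ-exp : ∀ a n → θ (exp a) (suc n) ≡ a * exp a n
  θ-exp a n = trans (egf-θ (a ^ℚ_) n) (*-assoc a (a ^ℚ n) (1/fact n))

  ⊛-*ˡ : ∀ a f g n → ((λ k → a * f k) ⊛ g) n ≡ a * (f ⊛ g) n
  ⊛-*ˡ a f g n = trans
    (sum-cong-≗ λ (i : Fin (suc n)) → *-assoc a (f (toℕ i)) (g (n ∸ toℕ i)))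
    (sym (*-distribˡ-sum {suc n} a (λ i → f (toℕ i) * g (n ∸ toℕ i))))

  -- With S the series of s, d/dt (e^{at} S) = e^{at} (S′ + a S), which is the recursion of
  -- `expMul`. The derivative is taken as `θ` followed by removal of one factor t.
  exp-⊛-egf : ∀ a s n → fromℕ (n !) * (exp a ⊛ egf s) n ≡ expMul a s n
  exp-⊛-egf a s zero    = unit (s 0)
    where
    unit : ∀ x → 1ℚ * (1ℚ * 1ℚ * (x * 1ℚ) + 0ℚ) ≡ x
    unit = solve-∀ ℚ-ring
  exp-⊛-egf a s (suc n) = begin
    fromℕ (suc n !) * (exp a ⊛ egf s) (suc n)
      ≡⟨ cong (_* (exp a ⊛ egf s) (suc n)) (fromℕ-* (suc n) (n !)) ⟩
    q * p * (exp a ⊛ egf s) (suc n)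
      ≡⟨ rearrange q p _ ⟩
    p * θ (exp a ⊛ egf s) (suc n)
      ≡⟨ cong (p *_) (θ-⊛ (exp a) (egf s) (suc n)) ⟩
    p * ((θ (exp a) ⊛ egf s) (suc n) + (exp a ⊛ θ (egf s)) (suc n))
      ≡⟨ cong₂ (λ x y → p * (x + y))
           (⊛-headˡ (θ (exp a)) (egf s) n (*-zeroˡ (exp a 0)))
           (⊛-headʳ (exp a) (θ (egf s)) n (*-zeroˡ (egf s 0))) ⟩
    p * ((shift (θ (exp a)) ⊛ egf s) n + (exp a ⊛ shift (θ (egf s))) n)
      ≡⟨ cong₂ (λ x y → p * (x + y))
           (trans (⊛-cong {g = egf s} (θ-exp a) (λ _ → refl) n) (⊛-*ˡ a (exp a) (egf s) n))
           (⊛-cong {exp a} (λ _ → refl) (egf-θ s) n) ⟩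
    p * (a * (exp a ⊛ egf s) n + (exp a ⊛ egf (shift s)) n)
      ≡⟨ distrib p a _ _ ⟩
    p * (exp a ⊛ egf (shift s)) n + a * (p * (exp a ⊛ egf s) n)
      ≡⟨ cong₂ (λ x y → x + a * y) (exp-⊛-egf a (shift s) n) (exp-⊛-egf a s n) ⟩
    expMul a (shift s) n + a * expMul a s n
      ≡⟨ expMul-linear a a (shift s) s n ⟨
    expMul a s (suc n) ∎
    where
    q = fromℕ (suc n)
    p = fromℕ (n !)
    rearrange : ∀ q p x → q * p * x ≡ p * (q * x)
    rearrange = solve-∀ ℚ-ring
    distrib : ∀ p a x y → p * (a * x + y) ≡ p * y + a * (p * x)
    distrib = solve-∀ ℚ-ring

  E-expMul : ∀ n → expMul 1ℚ E n + expMul (- 1ℚ) E n ≡ fromℕ (n !) * const (fromℕ 2) n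
  E-expMul n = begin
    expMul 1ℚ E n + expMul (- 1ℚ) E n
      ≡⟨ cong₂ _+_ (exp-⊛-egf 1ℚ E n) (exp-⊛-egf (- 1ℚ) E n) ⟨
    p * (exp 1ℚ ⊛ egf E) n + p * (exp (- 1ℚ) ⊛ egf E) n
      ≡⟨ *-distribˡ-+ p ((exp 1ℚ ⊛ egf E) n) ((exp (- 1ℚ) ⊛ egf E) n) ⟨
    p * ((exp 1ℚ ⊛ egf E) n + (exp (- 1ℚ) ⊛ egf E) n)
      ≡⟨ cong (p *_) (⊛-distribʳ (exp 1ℚ) (exp (- 1ℚ)) (egf E) n) ⟨
    p * ((exp 1ℚ ⊕ exp (- 1ℚ)) ⊛ egf E) n
      ≡⟨ cong (p *_) (E-generatingFunction n) ⟩
    p * const (fromℕ 2) n ∎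
    where p = fromℕ (n !)

  -- Multiplication by t in the basis tⁿ/n!. Thus `tMul E` represents t sech t, and its entry at 2k
  -- + 1 is (2k + 1) E(2k).
  tMul : (ℕ → ℚ) → ℕ → ℚ
  tMul s zero    = 0ℚ
  tMul s (suc n) = ι (suc n) * s n

  -- Multiplications by t and by e^{at} commute. The induction rests on (D + a)(t S) = t (D + a) S +
  -- S.
  expMul-tMul : ∀ a s n → expMul a (tMul s) n ≡ tMul (expMul a s) n
  expMul-tMul a s zero    = refl
  expMul-tMul a s (suc n) = begin
    expMul a (λ k → tMul s (suc k) + a * tMul s k) n
      ≡⟨ expMul-cong a leibniz n ⟩
    expMul a (λ k → tMul s′ k + 1ℚ * s k) n
      ≡⟨ expMul-linear a 1ℚ (tMul s′) s n ⟩
    expMul a (tMul s′) n + 1ℚ * expMul a s n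
      ≡⟨ cong (_+ 1ℚ * expMul a s n) (expMul-tMul a s′ n) ⟩
    tMul (expMul a s′) n + 1ℚ * expMul a s n
      ≡⟨ collect n ⟩
    ι (suc n) * expMul a s n ∎
    where
    s′ : ℕ → ℚ
    s′ k = s (suc k) + a * s k

    leibniz₀ : ∀ a x → (1ℚ + 0ℚ) * x + a * 0ℚ ≡ 0ℚ + 1ℚ * x
    leibniz₀ = solve-∀ ℚ-ring

    leibniz₁ : ∀ a q x y → (1ℚ + q) * x + a * (q * y) ≡ q * (x + a * y) + 1ℚ * x
    leibniz₁ = solve-∀ ℚ-ring

    leibniz : ∀ k → tMul s (suc k) + a * tMul s k ≡ tMul s′ k + 1ℚ * s k
    leibniz zero    = leibniz₀ a (s 0)
    leibniz (suc k) = leibniz₁ a (ι (suc k)) (s (suc k)) (s k)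

    collect₀ : ∀ x → 0ℚ + 1ℚ * x ≡ (1ℚ + 0ℚ) * x
    collect₀ = solve-∀ ℚ-ring

    collect₁ : ∀ q x → q * x + 1ℚ * x ≡ (1ℚ + q) * x
    collect₁ = solve-∀ ℚ-ring

    collect : ∀ n → tMul (expMul a s′) n + 1ℚ * expMul a s n ≡ ι (suc n) * expMul a s n
    collect zero    = collect₀ (s 0)
    collect (suc n) = collect₁ (ι (suc n)) (expMul a s (suc n))

  -- Products of D² - (2l+1)² and D² - (2l)² applied to t sech t.

  odd : ℕ → ℚ
  odd j = fromℕ 2 * ι j + 1ℚ

  -- Counted from 2, so that `even 0`, ..., `even (j − 1)` belong to the factors l = 1, ..., j.
  even : ℕ → ℚ
  even j = fromℕ 2 * ι (suc j)

  -- With D = d/dt acting as the shift, oddProd h j s is ∏_{l<j} (D² − h(2l+1)²) s and evenProd h j s is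
  -- D ∏_{l=1}^{j} (D² − h(2l)²) s.  Only h = 1 matters; it is written as h = a * a in
  -- evenProd-expMul so that a = 1 and a = −1 are covered by one ring identity.
  oddProd : ℚ → ℕ → (ℕ → ℚ) → ℕ → ℚ
  oddProd h zero    s k = s k
  oddProd h (suc j) s k = oddProd h j s (suc (suc k)) - h * (odd j * odd j) * oddProd h j s k

  evenProd : ℚ → ℕ → (ℕ → ℚ) → ℕ → ℚ
  evenProd h zero    s k = s (suc k)
  evenProd h (suc j) s k = evenProd h j s (suc (suc k)) - h * (even j * even j) * evenProd h j s k

  -- e^{−at} D e^{at} = D + a, and at h = a² the shifted product (D + a) ∏ ((D + a)² − h(2l)²)
  -- regroups as (D + a(2j + 1)) ∏_{l<j} (D² − h(2l+1)²).
  evenProd-expMul : ∀ a j s k → evenProd (a * a) j (expMul a s) k ≡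
             expMul a (λ n → oddProd (a * a) j s (suc n) + a * odd j * oddProd (a * a) j s n) k
  evenProd-expMul a zero    s k =
    expMul-cong a (λ n → cong (λ x → s (suc n) + x * s n) (sym (*-identityʳ a))) k
  evenProd-expMul a (suc j) s k = begin
    evenProd (a * a) j (expMul a s) (suc (suc k)) - c * evenProd (a * a) j (expMul a s) k
      ≡⟨ cong₂ (λ x y → x - c * y) (evenProd-expMul a j s (suc (suc k))) (evenProd-expMul a j s k) ⟩
    expMul a u (suc (suc k)) - c * expMul a u k
      ≡⟨ cong (expMul a u (suc (suc k)) +_) (neg-distribˡ-* c (expMul a u k)) ⟩
    expMul a u (suc (suc k)) + (- c) * expMul a u k
      ≡⟨ expMul-linear a (- c) _ u k ⟨
    expMul a (λ n → u (suc (suc n)) + a * u (suc n) + a * (u (suc n) + a * u n) + (- c) * u n) k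
      ≡⟨ expMul-cong a (λ n → factor a (ι j) (w n) (w (suc n)) (w (suc (suc n))) (w (suc (suc (suc n))))) k ⟩
    expMul a (λ n → oddProd (a * a) (suc j) s (suc n) + a * odd (suc j) * oddProd (a * a) (suc j) s n) k ∎
    where
    c = a * a * (even j * even j)
    w u : ℕ → ℚ
    w = oddProd (a * a) j s
    u n = w (suc n) + a * odd j * w n
    factor : ∀ a q w₀ w₁ w₂ w₃ →
      (w₃ + a * (fromℕ 2 * q + 1ℚ) * w₂) + a * (w₂ + a * (fromℕ 2 * q + 1ℚ) * w₁)
        + a * ((w₂ + a * (fromℕ 2 * q + 1ℚ) * w₁) + a * (w₁ + a * (fromℕ 2 * q + 1ℚ) * w₀))
        + (- (a * a * ((fromℕ 2 * (1ℚ + q)) * (fromℕ 2 * (1ℚ + q))))) * (w₁ + a * (fromℕ 2 * q + 1ℚ) * w₀)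
      ≡ (w₃ - a * a * ((fromℕ 2 * q + 1ℚ) * (fromℕ 2 * q + 1ℚ)) * w₁)
        + a * (fromℕ 2 * (1ℚ + q) + 1ℚ) * (w₂ - a * a * ((fromℕ 2 * q + 1ℚ) * (fromℕ 2 * q + 1ℚ)) * w₀)
    factor = solve-∀ ℚ-ring

  evenProd-+ : ∀ h j s u k → evenProd h j (λ n → s n + u n) k ≡ evenProd h j s k + evenProd h j u k
  evenProd-+ h zero    s u k = refl
  evenProd-+ h (suc j) s u k = trans
    (cong₂ (λ x y → x - h * (even j * even j) * y) (evenProd-+ h j s u (suc (suc k))) (evenProd-+ h j s u k))
    (rearrange (h * (even j * even j))
      (evenProd h j s (suc (suc k))) (evenProd h j u (suc (suc k))) (evenProd h j s k) (evenProd h j u k))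
    where
    rearrange : ∀ c x y z w → (x + y) - c * (z + w) ≡ (x - c * z) + (y - c * w)
    rearrange = solve-∀ ℚ-ring

  -- The coefficient of D in D ∏_{l=1}^{j} (D² − (2l)²).
  ρ : ℕ → ℚ
  ρ zero    = 1ℚ
  ρ (suc j) = - (even j * even j) * ρ j

  -- The operator contains one D and the further shift is a second one, while D² kills a polynomial
  -- of degree at most one.
  evenProd-suc : ∀ j s → (∀ k → s (suc (suc k)) ≡ 0ℚ) → ∀ k → evenProd 1ℚ j s (suc k) ≡ 0ℚ
  evenProd-suc zero    s s≡0 k = s≡0 k
  evenProd-suc (suc j) s s≡0 k = trans
    (cong₂ (λ x y → x - 1ℚ * (even j * even j) * y)
      (evenProd-suc j s s≡0 (suc (suc k))) (evenProd-suc j s s≡0 k))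
    (vanish (1ℚ * (even j * even j)))
    where
    vanish : ∀ c → 0ℚ - c * 0ℚ ≡ 0ℚ
    vanish = solve-∀ ℚ-ring

  -- Where D² acts as 0, each factor D² - (2l)² reduces to the scalar -(2l)².
  evenProd-0 : ∀ j s → (∀ k → s (suc (suc k)) ≡ 0ℚ) → evenProd 1ℚ j s 0 ≡ ρ j * s 1
  evenProd-0 zero    s s≡0 = sym (*-identityˡ (s 1))
  evenProd-0 (suc j) s s≡0 = trans
    (cong₂ (λ x y → x - 1ℚ * (even j * even j) * y) (evenProd-suc j s s≡0 1) (evenProd-0 j s s≡0))
    (rearrange (even j * even j) (ρ j) (s 1))
    where
    rearrange : ∀ c x y → 0ℚ - 1ℚ * c * (x * y) ≡ - c * x * y
    rearrange = solve-∀ ℚ-ring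

  evenProd-cong : ∀ h j {s u} → s ≗ u → evenProd h j s ≗ evenProd h j u
  evenProd-cong h zero    s≗u k = s≗u (suc k)
  evenProd-cong h (suc j) s≗u k =
    cong₂ (λ x y → x - h * (even j * even j) * y) (evenProd-cong h j s≗u (suc (suc k))) (evenProd-cong h j s≗u k)

  -- Apply evenProd 1ℚ j to (eᵗ + e⁻ᵗ) · t sech t = 2t and evaluate at t = 0.
  oddProd-1 : ∀ j → oddProd 1ℚ j (tMul E) 1 ≡ ρ j
  oddProd-1 j = begin
    oddProd 1ℚ j s 1
      -- Averaging over a = 1 and a = -1 cancels the value at index 0; for both, a * a computes to
      -- 1ℚ.
      ≡⟨ average (oddProd 1ℚ j s 1) (odd j) (oddProd 1ℚ j s 0) ⟩
    ½ * ((oddProd 1ℚ j s 1 + 1ℚ * odd j * oddProd 1ℚ j s 0)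
      + (oddProd 1ℚ j s 1 + (- 1ℚ) * odd j * oddProd 1ℚ j s 0))
      ≡⟨ cong₂ (λ x y → ½ * (x + y)) (evenProd-expMul 1ℚ j s 0) (evenProd-expMul (- 1ℚ) j s 0) ⟨
    ½ * (evenProd 1ℚ j (expMul 1ℚ s) 0 + evenProd 1ℚ j (expMul (- 1ℚ) s) 0)
      ≡⟨ cong (½ *_) (evenProd-+ 1ℚ j (expMul 1ℚ s) (expMul (- 1ℚ) s) 0) ⟨
    ½ * evenProd 1ℚ j (λ n → expMul 1ℚ s n + expMul (- 1ℚ) s n) 0
      ≡⟨ cong (½ *_) (evenProd-0 j _ (λ k → value (suc k))) ⟩
    ½ * (ρ j * (expMul 1ℚ s 1 + expMul (- 1ℚ) s 1))
      ≡⟨ cong (λ x → ½ * (ρ j * x)) (value 0) ⟩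
    ½ * (ρ j * fromℕ 2)
      ≡⟨ half (ρ j) ⟩
    ρ j ∎
    where
    s : ℕ → ℚ
    s = tMul E
    average : ∀ x q y → x ≡ ½ * ((x + 1ℚ * q * y) + (x + (- 1ℚ) * q * y))
    average = solve-∀ ℚ-ring
    half : ∀ x → ½ * (x * fromℕ 2) ≡ x
    half = solve-∀ ℚ-ring
    evaluate : ∀ k → ι (suc k) * (fromℕ (k !) * const (fromℕ 2) k) ≡ const (fromℕ 2) k
    evaluate zero    = refl
    evaluate (suc k) = trans
      (cong (ι (suc (suc k)) *_) (*-zeroʳ (fromℕ (suc k !))))
      (*-zeroʳ (ι (suc (suc k))))
    value : ∀ k → expMul 1ℚ s (suc k) + expMul (- 1ℚ) s (suc k) ≡ const (fromℕ 2) k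
    value k = begin
      expMul 1ℚ s (suc k) + expMul (- 1ℚ) s (suc k)
        ≡⟨ cong₂ _+_ (expMul-tMul 1ℚ E (suc k)) (expMul-tMul (- 1ℚ) E (suc k)) ⟩
      ι (suc k) * expMul 1ℚ E k + ι (suc k) * expMul (- 1ℚ) E k
        ≡⟨ *-distribˡ-+ (ι (suc k)) (expMul 1ℚ E k) (expMul (- 1ℚ) E k) ⟨
      ι (suc k) * (expMul 1ℚ E k + expMul (- 1ℚ) E k)
        ≡⟨ cong (ι (suc k) *_) (E-expMul k) ⟩
      ι (suc k) * (fromℕ (k !) * const (fromℕ 2) k)
        ≡⟨ evaluate k ⟩
      const (fromℕ 2) k ∎

  -- Moments in the Newton basis, the three-term recurrence and orthogonality.

  -- X i k = L(yⁱ ∏_{l<k} (y − (2l+1)²)) for the linear functional L with L(yᵏ) = (2k + 1) E(2k).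
  X : ℕ → ℕ → ℚ
  X i k = oddProd 1ℚ k (tMul E) (suc (2 ℕ.* i))

  -- Multiplication by y in the Newton basis: y = (y - (2k+1)²) + (2k+1)².
  X-suc : ∀ i k → X (suc i) k ≡ X i (suc k) + odd k * odd k * X i k
  X-suc i k = begin
    oddProd 1ℚ k s (suc (2 ℕ.* suc i))   ≡⟨ cong (oddProd 1ℚ k s ∘ suc) (ℕ.*-suc 2 i) ⟩
    y                              ≡⟨ rearrange y (odd k * odd k) (X i k) ⟩
    X i (suc k) + odd k * odd k * X i k ∎
    where
    s = tMul E
    y = oddProd 1ℚ k s (suc (suc (suc (2 ℕ.* i))))
    rearrange : ∀ y c x → y ≡ (y - 1ℚ * c * x) + c * x
    rearrange = solve-∀ ℚ-ring

  -- Its square is -d(m + k + 1) / d(m + k) for d(k) = (-4)ᵏ k!².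
  weight : ℕ → ℕ → ℚ
  weight m k = fromℕ 2 * (ι (suc m) + ι k)

  -- With d(k) = (−4)ᵏ k!², this is Z x m k = d(m + k) · Δᵐ(x / d)(k), free of division.
  Z : (ℕ → ℚ) → ℕ → ℕ → ℚ
  Z x zero    k = x k
  Z x (suc m) k = Z x m (suc k) + weight m k * weight m k * Z x m k

  -- At k = 0 these become, up to sign and scaling, the three-term recurrence coefficients of the
  -- continuous dual Hahn polynomials with parameters ½, ½, ½.
  β : ℕ → ℕ → ℚ
  β m k = fromℕ 8 * (ι m * ι m) + fromℕ 8 * ι m + fromℕ 3 + fromℕ 4 * ι k * (1ℚ + fromℕ 2 * ι m)

  γ : ℕ → ℕ → ℚ
  γ m k = even m * even m * (weight m k * weight m k)

  -- The hypothesis is the shape of `X-suc`: the sequence y comes from x by multiplying the argument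
  -- of L by the variable.
  module _ {x y : ℕ → ℚ} (y≡ : ∀ k → y k ≡ x (suc k) + odd k * odd k * x k) where

    Z-zero-recurrence : ∀ k → Z y 0 k ≡ Z x 1 k - β 0 k * Z x 0 k
    Z-zero-recurrence k = trans (y≡ k) (identity (ι k) (x k) (x (suc k)))
      where
      identity : ∀ p a b →
        b + (fromℕ 2 * p + 1ℚ) * (fromℕ 2 * p + 1ℚ) * a ≡
        (b + fromℕ 2 * ((1ℚ + 0ℚ) + p) * (fromℕ 2 * ((1ℚ + 0ℚ) + p)) * a)
          - (fromℕ 8 * (0ℚ * 0ℚ) + fromℕ 8 * 0ℚ + fromℕ 3 + fromℕ 4 * p * (1ℚ + fromℕ 2 * 0ℚ)) * a
      identity = solve-∀ ℚ-ring

    -- Induction on m. The recursion of `Z` reads column k + 1, so even for the case k = 0, which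
    -- yields orthogonality, the coefficients must be known for every k.
    Z-recurrence : ∀ m k →
      Z y (suc m) k ≡ Z x (suc (suc m)) k - β (suc m) k * Z x (suc m) k + γ m k * Z x m k
    Z-recurrence zero k = begin
      Z y 0 (suc k) + weight 0 k * weight 0 k * Z y 0 k
        ≡⟨ cong₂ (λ a b → a + weight 0 k * weight 0 k * b)
             (Z-zero-recurrence (suc k)) (Z-zero-recurrence k) ⟩
      (Z x 1 (suc k) - β 0 (suc k) * Z x 0 (suc k))
        + weight 0 k * weight 0 k * (Z x 1 k - β 0 k * Z x 0 k)
        ≡⟨ identity (ι k) (Z x 0 k) (Z x 0 (suc k)) (Z x 1 (suc k)) ⟩
      Z x 2 k - β 1 k * Z x 1 k + γ 0 k * Z x 0 k ∎
      where
      identity : ∀ p a₀ a₁ b₁ →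
        let w₀ = fromℕ 2 * ((1ℚ + 0ℚ) + p)
            w₁ = fromℕ 2 * ((1ℚ + (1ℚ + 0ℚ)) + p)
            e₀ = fromℕ 2 * (1ℚ + 0ℚ)
            β′ = λ q p → fromℕ 8 * (q * q) + fromℕ 8 * q + fromℕ 3 + fromℕ 4 * p * (1ℚ + fromℕ 2 * q)
            b₀ = a₁ + w₀ * w₀ * a₀
        in
        (b₁ - β′ 0ℚ (1ℚ + p) * a₁) + w₀ * w₀ * (b₀ - β′ 0ℚ p * a₀) ≡
        (b₁ + w₁ * w₁ * b₀) - β′ (1ℚ + 0ℚ) p * b₀ + e₀ * e₀ * (w₀ * w₀) * a₀
      identity = solve-∀ ℚ-ring
    Z-recurrence (suc m) k = begin
      Z y (suc m) (suc k) + w * Z y (suc m) k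
        ≡⟨ cong₂ (λ a b → a + w * b) (Z-recurrence m (suc k)) (Z-recurrence m k) ⟩
      (Z x (suc (suc m)) (suc k) - β (suc m) (suc k) * Z x (suc m) (suc k) + γ m (suc k) * Z x m (suc k))
        + w * (Z x (suc (suc m)) k - β (suc m) k * Z x (suc m) k + γ m k * Z x m k)
        ≡⟨ identity (ι m) (ι k) (Z x m k) (Z x m (suc k)) (Z x (suc m) (suc k)) (Z x (suc (suc m)) (suc k)) ⟩
      Z x (suc (suc (suc m))) k - β (suc (suc m)) k * Z x (suc (suc m)) k + γ (suc m) k * Z x (suc m) k ∎
      where
      w = weight (suc m) k * weight (suc m) k
      -- Letters a, b, c stand for levels m, m + 1, m + 2 of `Z x`, subscripts 0 and 1 for columns k
      -- and k + 1. Expanding b₀ and c₀ by the recursion leaves a polynomial identity in free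
      -- variables.
      identity : ∀ q p a₀ a₁ b₁ c₁ →
        let w₀ = fromℕ 2 * ((1ℚ + q) + p)
            w₀′ = fromℕ 2 * ((1ℚ + q) + (1ℚ + p))
            w₁ = fromℕ 2 * ((1ℚ + (1ℚ + q)) + p)
            w₂ = fromℕ 2 * ((1ℚ + (1ℚ + (1ℚ + q))) + p)
            e₀ = fromℕ 2 * (1ℚ + q)
            e₁ = fromℕ 2 * (1ℚ + (1ℚ + q))
            β′ = λ q p → fromℕ 8 * (q * q) + fromℕ 8 * q + fromℕ 3 + fromℕ 4 * p * (1ℚ + fromℕ 2 * q)
            b₀ = a₁ + w₀ * w₀ * a₀
            c₀ = b₁ + w₁ * w₁ * b₀
        in
        (c₁ - β′ (1ℚ + q) (1ℚ + p) * b₁ + e₀ * e₀ * (w₀′ * w₀′) * a₁)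
          + w₁ * w₁ * (c₀ - β′ (1ℚ + q) p * b₀ + e₀ * e₀ * (w₀ * w₀) * a₀) ≡
        (c₁ + w₂ * w₂ * c₀) - β′ (1ℚ + (1ℚ + q)) p * c₀ + e₁ * e₁ * (w₁ * w₁) * b₀
      identity = solve-∀ ℚ-ring

  -- By `oddProd-1` the row `X 0` is `ρ`, which is d itself; the quotient by d is constantly 1 and
  -- its differences vanish.
  Z-row₀ : ∀ m k → Z (X 0) (suc m) k ≡ 0ℚ
  Z-row₀ zero    k = begin
    X 0 (suc k) + weight 0 k * weight 0 k * X 0 k
      ≡⟨ cong₂ (λ a b → a + weight 0 k * weight 0 k * b) (oddProd-1 (suc k)) (oddProd-1 k) ⟩
    ρ (suc k) + weight 0 k * weight 0 k * ρ k
      ≡⟨ identity (ι k) (ρ k) ⟩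
    0ℚ ∎
    where
    identity : ∀ p x →
      - (fromℕ 2 * (1ℚ + p) * (fromℕ 2 * (1ℚ + p))) * x
        + fromℕ 2 * ((1ℚ + 0ℚ) + p) * (fromℕ 2 * ((1ℚ + 0ℚ) + p)) * x ≡ 0ℚ
    identity = solve-∀ ℚ-ring
  Z-row₀ (suc m) k = trans
    (cong₂ (λ a b → a + weight (suc m) k * weight (suc m) k * b) (Z-row₀ m (suc k)) (Z-row₀ m k))
    (trans (+-identityˡ _) (*-zeroʳ (weight (suc m) k * weight (suc m) k)))

  -- Orthogonality of the j-th polynomial to yⁱ. The recurrence writes an entry of row i + 1 through
  -- three entries of row i, all still above the diagonal.
  Z-upper : ∀ i j → i ℕ.< j → Z (X i) j 0 ≡ 0ℚ
  Z-upper zero    (suc j) _   = Z-row₀ j 0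
  Z-upper (suc i) (suc j) i<j = begin
    Z (X (suc i)) (suc j) 0
      ≡⟨ Z-recurrence (X-suc i) j 0 ⟩
    Z (X i) (suc (suc j)) 0 - β (suc j) 0 * Z (X i) (suc j) 0 + γ j 0 * Z (X i) j 0
      ≡⟨ cong₂ _+_
           (cong₂ (λ a b → a - β (suc j) 0 * b)
             (Z-upper i (suc (suc j)) (ℕ.m<n⇒m<1+n (ℕ.<⇒≤ i<j)))
             (Z-upper i (suc j) (ℕ.<⇒≤ i<j)))
           (cong (γ j 0 *_) (Z-upper i j (ℕ.s<s⁻¹ i<j))) ⟩
    0ℚ - β (suc j) 0 * 0ℚ + γ j 0 * 0ℚ
      ≡⟨ vanish (β (suc j) 0) (γ j 0) ⟩
    0ℚ ∎
    where
    vanish : ∀ b c → 0ℚ - b * 0ℚ + c * 0ℚ ≡ 0ℚ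
    vanish = solve-∀ ℚ-ring

  -- Diagonal entries and their product.

  -- The value of L at the square of the i-th monic orthogonal polynomial.
  pivot : ℕ → ℕ
  pivot i = 16 ℕ.^ i ℕ.* (i !) ℕ.^ 4

  pivot-suc : ∀ i → pivot (suc i) ≡
    (2 ℕ.* suc i) ℕ.* (2 ℕ.* suc i) ℕ.* ((2 ℕ.* suc i) ℕ.* (2 ℕ.* suc i)) ℕ.* pivot i
  pivot-suc i = identity (16 ℕ.^ i) (suc i) (i !)
    where
    identity : ∀ a q f →
      16 ℕ.* a ℕ.* (q ℕ.* f ℕ.* (q ℕ.* f ℕ.* (q ℕ.* f ℕ.* (q ℕ.* f ℕ.* 1)))) ≡
      (2 ℕ.* q) ℕ.* (2 ℕ.* q) ℕ.* ((2 ℕ.* q) ℕ.* (2 ℕ.* q)) ℕ.* (a ℕ.* (f ℕ.* (f ℕ.* (f ℕ.* (f ℕ.* 1)))))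
    identity = ℕ-ring.solve-∀

  -- Two of the three terms of the recurrence lie above the diagonal, so consecutive pivots have
  -- ratio `γ i 0` = (2(i + 1))⁴.
  Z-diagonal : ∀ i → Z (X i) i 0 ≡ fromℕ (pivot i)
  Z-diagonal zero    = oddProd-1 0
  Z-diagonal (suc i) = begin
    Z (X (suc i)) (suc i) 0
      ≡⟨ Z-recurrence (X-suc i) i 0 ⟩
    Z (X i) (suc (suc i)) 0 - β (suc i) 0 * Z (X i) (suc i) 0 + γ i 0 * Z (X i) i 0
      ≡⟨ cong₂ _+_
           (cong₂ (λ a b → a - β (suc i) 0 * b)
             (Z-upper i (suc (suc i)) (ℕ.m<n⇒m<1+n (ℕ.n<1+n i)))
             (Z-upper i (suc i) (ℕ.n<1+n i)))
           (cong (γ i 0 *_) (Z-diagonal i)) ⟩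
    0ℚ - β (suc i) 0 * 0ℚ + γ i 0 * fromℕ (pivot i)
      ≡⟨ identity (β (suc i) 0) (ι (suc i)) (fromℕ (pivot i)) ⟩
    even i * even i * (even i * even i) * fromℕ (pivot i)
      ≡⟨ cong (λ e → e * e * (e * e) * fromℕ (pivot i)) even≡ ⟩
    fromℕ e * fromℕ e * (fromℕ e * fromℕ e) * fromℕ (pivot i)
      ≡⟨ cong (λ z → z * z * fromℕ (pivot i)) (fromℕ-* e e) ⟨
    fromℕ (e ℕ.* e) * fromℕ (e ℕ.* e) * fromℕ (pivot i)
      ≡⟨ cong (_* fromℕ (pivot i)) (fromℕ-* (e ℕ.* e) (e ℕ.* e)) ⟨
    fromℕ (e ℕ.* e ℕ.* (e ℕ.* e)) * fromℕ (pivot i)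
      ≡⟨ fromℕ-* (e ℕ.* e ℕ.* (e ℕ.* e)) (pivot i) ⟨
    fromℕ (e ℕ.* e ℕ.* (e ℕ.* e) ℕ.* pivot i)
      ≡⟨ cong fromℕ (pivot-suc i) ⟨
    fromℕ (pivot (suc i)) ∎
    where
    e = 2 ℕ.* suc i
    even≡ : even i ≡ fromℕ e
    even≡ = trans (cong (fromℕ 2 *_) (sym (fromℕ≡ι (suc i)))) (sym (fromℕ-* 2 (suc i)))
    identity : ∀ b q d →
      0ℚ - b * 0ℚ + fromℕ 2 * q * (fromℕ 2 * q) * (fromℕ 2 * (q + 0ℚ) * (fromℕ 2 * (q + 0ℚ))) * d ≡
      fromℕ 2 * q * (fromℕ 2 * q) * (fromℕ 2 * q * (fromℕ 2 * q)) * d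
    identity = solve-∀ ℚ-ring

  H-pivots : ∀ n →
    H n (λ k → fromℕ (2 ℕ.* k ℕ.+ 1) * E (2 ℕ.* k)) ≡ fromℕ (product (applyUpTo pivot (suc n)))
  H-pivots n = begin
    det {suc n} (λ i j → c (toℕ i ℕ.+ toℕ j))
      ≡⟨ det-cong {suc n} (λ i j → c≡X (toℕ i ℕ.+ toℕ j)) ⟩
    det (columns {suc n} λ i k → X (toℕ i ℕ.+ k) 0)
      -- First pass: level m, column k holds L(yⁱ⁺ᵏ ∏_{l<m} (y - (2l+1)²)), so the left edge trades
      -- powers of y for Newton products.
      ≡⟨ det-triangle {suc n} (λ i m k → X (toℕ i ℕ.+ k) m) (λ m _ → - (odd m * odd m)) (λ i → newton (toℕ i)) ⟩
    det (columns {suc n} λ i k → X (toℕ i ℕ.+ 0) k)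
      ≡⟨ det-cong {suc n} (λ i j → cong (λ l → X l (toℕ j)) (ℕ.+-identityʳ (toℕ i))) ⟩
    det (columns {suc n} λ i → X (toℕ i))
      -- Second pass, to the orthogonal polynomials; the recursion required is the definition of
      -- `Z`.
      ≡⟨ det-triangle {suc n} (λ i → Z (X (toℕ i))) (λ m k → weight m k * weight m k) (λ _ _ _ → refl) ⟩
    det (columns {suc n} λ i m → Z (X (toℕ i)) m 0)
      ≡⟨ det-lower {suc n} (λ i m → Z (X i) m 0) pivot Z-upper Z-diagonal ⟩
    fromℕ (product (applyUpTo pivot (suc n))) ∎
    where
    c : ℕ → ℚ
    c k = fromℕ (2 ℕ.* k ℕ.+ 1) * E (2 ℕ.* k)

    c≡X : ∀ k → c k ≡ X k 0
    c≡X k = cong (_* E (2 ℕ.* k)) (trans (fromℕ≡ι (2 ℕ.* k ℕ.+ 1)) (cong ι (ℕ.+-comm (2 ℕ.* k) 1)))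

    rearrange : ∀ x c y → x ≡ (x + c * y) + (- c) * y
    rearrange = solve-∀ ℚ-ring

    newton : ∀ i m k → X (i ℕ.+ k) (suc m) ≡ X (i ℕ.+ suc k) m + - (odd m * odd m) * X (i ℕ.+ k) m
    newton i m k = begin
      X (i ℕ.+ k) (suc m)
        ≡⟨ rearrange (X (i ℕ.+ k) (suc m)) (odd m * odd m) (X (i ℕ.+ k) m) ⟩
      (X (i ℕ.+ k) (suc m) + odd m * odd m * X (i ℕ.+ k) m) + - (odd m * odd m) * X (i ℕ.+ k) m
        ≡⟨ cong (_+ - (odd m * odd m) * X (i ℕ.+ k) m) (X-suc (i ℕ.+ k) m) ⟨
      X (suc (i ℕ.+ k)) m + - (odd m * odd m) * X (i ℕ.+ k) m
        ≡⟨ cong (λ l → X l m + - (odd m * odd m) * X (i ℕ.+ k) m) (ℕ.+-suc i k) ⟨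
      X (i ℕ.+ suc k) m + - (odd m * odd m) * X (i ℕ.+ k) m ∎

  product-applyUpTo-suc : ∀ (f : ℕ → ℕ) n → product (applyUpTo f (suc n)) ≡ product (applyUpTo f n) ℕ.* f n
  product-applyUpTo-suc f n = begin
    product (applyUpTo f (suc n))                ≡⟨ cong product (applyUpTo-∷ʳ f n) ⟨
    product (applyUpTo f n ∷ʳ f n) ≡⟨ product-++ (applyUpTo f n) (f n ∷ []) ⟩
    product (applyUpTo f n) ℕ.* (f n ℕ.* 1)      ≡⟨ cong (product (applyUpTo f n) ℕ.*_) (ℕ.*-identityʳ (f n)) ⟩
    product (applyUpTo f n) ℕ.* f n              ∎

  -- The powers of 16 = 2⁴ combine to the exponent 4(0 + 1 + ... + n) = 2n(n + 1). The pivot of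
  -- index 0 is 1, so the remaining factors are indexed by `suc ℓ`.
  product-pivots : ∀ n → product (applyUpTo pivot (suc n)) ≡
    2 ℕ.^ (2 ℕ.* n ℕ.* (n ℕ.+ 1)) ℕ.* product (map (λ ℓ → ((suc ℓ) !) ℕ.^ 4) (upTo n))
  product-pivots n = trans (by-applyUpTo n)
    (cong (λ l → 2 ℕ.^ (2 ℕ.* n ℕ.* (n ℕ.+ 1)) ℕ.* product l) (sym (map-upTo f n)))
    where
    f : ℕ → ℕ
    f ℓ = ((suc ℓ) !) ℕ.^ 4

    exponent : ∀ n → 2 ℕ.* n ℕ.* (n ℕ.+ 1) ℕ.+ 4 ℕ.* suc n ≡ 2 ℕ.* suc n ℕ.* (suc n ℕ.+ 1)
    exponent = ℕ-ring.solve-∀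

    regroup : ∀ a b c d → a ℕ.* b ℕ.* (c ℕ.* d) ≡ a ℕ.* c ℕ.* (b ℕ.* d)
    regroup = ℕ-ring.solve-∀

    by-applyUpTo : ∀ n → product (applyUpTo pivot (suc n)) ≡
      2 ℕ.^ (2 ℕ.* n ℕ.* (n ℕ.+ 1)) ℕ.* product (applyUpTo f n)
    by-applyUpTo zero    = refl
    by-applyUpTo (suc n) = begin
      product (applyUpTo pivot (suc (suc n)))
        ≡⟨ product-applyUpTo-suc pivot (suc n) ⟩
      product (applyUpTo pivot (suc n)) ℕ.* (16 ℕ.^ suc n ℕ.* f n)
        ≡⟨ cong (ℕ._* (16 ℕ.^ suc n ℕ.* f n)) (by-applyUpTo n) ⟩
      2 ℕ.^ u ℕ.* product (applyUpTo f n) ℕ.* (16 ℕ.^ suc n ℕ.* f n)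
        ≡⟨ regroup (2 ℕ.^ u) (product (applyUpTo f n)) (16 ℕ.^ suc n) (f n) ⟩
      2 ℕ.^ u ℕ.* 16 ℕ.^ suc n ℕ.* (product (applyUpTo f n) ℕ.* f n)
        ≡⟨ cong₂ ℕ._*_ powers (sym (product-applyUpTo-suc f n)) ⟩
      2 ℕ.^ (2 ℕ.* suc n ℕ.* (suc n ℕ.+ 1)) ℕ.* product (applyUpTo f (suc n)) ∎
      where
      u = 2 ℕ.* n ℕ.* (n ℕ.+ 1)
      powers : 2 ℕ.^ u ℕ.* 16 ℕ.^ suc n ≡ 2 ℕ.^ (2 ℕ.* suc n ℕ.* (suc n ℕ.+ 1))
      powers = begin
        2 ℕ.^ u ℕ.* 16 ℕ.^ suc n        ≡⟨ cong (2 ℕ.^ u ℕ.*_) (ℕ.^-*-assoc 2 4 (suc n)) ⟩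
        2 ℕ.^ u ℕ.* 2 ℕ.^ (4 ℕ.* suc n) ≡⟨ ℕ.^-distribˡ-+-* 2 u (4 ℕ.* suc n) ⟨
        2 ℕ.^ (u ℕ.+ 4 ℕ.* suc n)       ≡⟨ cong (2 ℕ.^_) (exponent n) ⟩
        2 ℕ.^ (2 ℕ.* suc n ℕ.* (suc n ℕ.+ 1)) ∎

open import Data.Nat.Base using (ℕ; suc; _+_; _*_; _^_; _!)
open import Data.Nat.ListAction using (product)
open import Data.List.Base using (map; upTo)
import Data.Rational.Base as ℚ
open import Relation.Binary.PropositionalEquality using (_≡_; cong; trans)

corollary5p2 : (n : ℕ) →
    H n (λ k → fromℕ (2 * k + 1) ℚ.* E (2 * k))
    ≡ fromℕ (2 ^ (2 * n * (n + 1)) * product (map (λ ℓ → ((suc ℓ) !) ^ 4) (upTo n)))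
corollary5p2 n = trans (HankelOfEuler.H-pivots n) (cong fromℕ (HankelOfEuler.product-pivots n))
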